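{- Let $A$ be a finite alphabet with an involution $\theta$ (possibly with fixed points) and let $T$ be a linear involution relative to $A$ (and $\theta$) without connections. Then the natural coding $\mathcal{L}(T)$ of $T$ is a specular set on $A$ relative to $\theta$.
   Context: Specular sets. A set $S$ of words on $A$ is factorial if it contains $A$ and all the factors of its elements; $\varepsilon$ is the empty word. For $w\in S$ let $L(w)=\{a\in A\mid aw\in S\}$, $R(w)=\{a\in A\mid wa\in S\}$, $B(w)=\{(a,b)\in A\times A\mid awb\in S\}$. A factorial set $S$ is biextendable if $B(w)\neq\emptyset$ for all $w\in S$. The extension graph $\mathcal{E}(w)$ is the undirected graph whose vertex set is the disjoint union of $L(w)$ and $R(w)$ and whose edges are the pairs in $B(w)$. A biextendable set is a tree set of characteristic $2$ if $\mathcal{E}(w)$ is a tree for every nonempty $w\in S$ and $\mathcal{E}(\varepsilon)$ is a disjoint union of two trees. Let $G_\theta$ be the group generated by $A$ with relations $a\theta(a)=1$, so $a^{ -1}=\theta(a)$. A word is reduced if it has no factor $a\theta(a)$, $a\in A$; the inverse of a reduced word $a_1\cdots a_n$ is $\theta(a_n)\cdots\theta(a_1)$. A specular set relative to $\theta$ is a biextendable set of reduced words, closed under taking inverses, which is a tree set of characteristic $2$. Linear involutions. Let $k=\mathrm{Card}(A)$, let $I$ be an open interval of the real line and $\hat I=I\times\{0,1\}$, with components $I\times\{0\}$ and $I\times\{1\}$, each regarded as an open interval. Let $\ell+m=k$ and let $\pi:\{1,\dots,k\}\to A$ be a bijection (generalized permutation of type $(\ell,m)$). Let $\lambda\in\mathbb{R}^A$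 be a vector with positive entries such that $\lambda_{\pi(1)}+\dots+\lambda_{\pi(\ell)}=\lambda_{\pi(\ell+1)}+\dots+\lambda_{\pi(k)}$ (this common value being the length of $I$) and $\lambda_a=\lambda_{a^{ -1}}$ for all $a\in A$. Partition $I\times\{0\}$, minus $\ell-1$ points, into consecutive (left to right) open intervals $I_{\pi(1)},\dots,I_{\pi(\ell)}$ of lengths $\lambda_{\pi(1)},\dots,\lambda_{\pi(\ell)}$, and $I\times\{1\}$, minus $m-1$ points, into consecutive open intervals $I_{\pi(\ell+1)},\dots,I_{\pi(k)}$ of lengths $\lambda_{\pi(\ell+1)},\dots,\lambda_{\pi(k)}$. Let $\Sigma$ be the set of the $k-2$ division points separating the intervals $I_a$. A linear involution relative to these data is the map $T=\sigma_2\circ\sigma_1$ on $\hat I\setminus\Sigma$, where $\sigma_1$ is an involution of $\hat I\setminus\Sigma$ whose restriction to each $I_a$ is either a translation or a symmetry (orientation-reversing isometry) from $I_a$ onto $I_{a^{ -1}}$, and $\sigma_2(x,\delta)=(x,1-\delta)$. The singularities of $T$ are the points of $\Sigma$, and those of $T^{ -1}=\sigma_1\circ\sigma_2$ are the points of $\sigma_2(\Sigma)$. A connection of $T$ is a triple $(x,y,n)$ with $x$ a singularity of $T^{ -1}$, $y$ a singularity of $T$, $n\ge0$ and $T^nx=y$. Natural coding. Let $O=\bigcup_{n\ge0}T^{ -n}(\Sigma)$ and $\hat O=O\cup\sigma_2(O)$. If $T$ has no connections, $T$ is a bijection of $\hat I\setminus\hat O$ onto itself. For $z\in\hat I\setminus\hat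 O$, the infinite natural coding of $T$ relative to $z$ is the infinite word $a_0a_1\cdots$ with $a_n=a$ if $T^n(z)\in I_a$. The natural coding $\mathcal{L}(T)$ is the set of all (finite) factors of the infinite natural codings of $T$ relative to points $z\in\hat I\setminus\hat O$. -}

module Defs where

open import Algebra.Bundles using (CommutativeRing)
open import Data.Bool using (Bool; true; false; not)
open import Data.Empty using (⊥)
open import Data.Fin using (Fin; Fin′; inject; splitAt; _↑ˡ_; _↑ʳ_)
open import Data.List using (List; []; _∷_; [_]; _++_; _∷ʳ_; map; reverse; length; applyUpTo)
open import Data.List.Relation.Unary.Linked using (Linked)
open import Data.List.Relation.Unary.Unique.Propositional using (Unique)
import Data.Nat as ℕ
open import Data.Nat using (ℕ; zero; suc)
open import Data.Product using (∃; _×_; _,_; proj₁; proj₂)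
open import Data.Sum using (_⊎_; inj₁; inj₂; [_,_]′)
open import Data.Vec.Functional using (Vector)
open import Function using (_∘_; _↔_; Inverse)
open import Level using (0ℓ)
open import Relation.Binary.Core using (Rel)
open import Relation.Binary.Construct.Closure.ReflexiveTransitive using (Star)
open import Relation.Binary.Definitions using (Symmetric)
open import Relation.Binary.PropositionalEquality using (_≡_; _≢_)
open import Relation.Binary.Structures using (IsStrictTotalOrder)
open import Relation.Nullary using (¬_)
open import Relation.Unary using (Pred; _∈_; _∉_)
import Algebra.Definitions.RawMonoid as RawMonoidDefinitions

-- The real line, by its characterisation (unique up to isomorphism) as the
-- Dedekind-complete ordered field.  Equality is the setoid equality _≈_ of the
-- underlying ring.
record Reals : Set₁ where
  field
    commutativeRing : CommutativeRing 0ℓ 0ℓ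
  open CommutativeRing commutativeRing public
  infix 4 _<_ _≤_
  field
    _<_                : Rel Carrier 0ℓ
    isStrictTotalOrder : IsStrictTotalOrder _≈_ _<_
    0<1                : 0# < 1#
    +-monoˡ-<          : ∀ z {x y} → x < y → x + z < y + z
    *-pos              : ∀ {x y} → 0# < x → 0# < y → 0# < x * y
    *-inverse          : ∀ x → ¬ (x ≈ 0#) → ∃ λ y → x * y ≈ 1#

  _≤_ : Rel Carrier 0ℓ
  x ≤ y = ¬ (y < x)

  UpperBound : Pred Carrier 0ℓ → Pred Carrier 0ℓ
  UpperBound P u = ∀ x → x ∈ P → x ≤ u

  field
    complete : (P : Pred Carrier 0ℓ) → ∃ P → ∃ (UpperBound P) →
               ∃ λ s → s ∈ UpperBound P × (∀ u → u ∈ UpperBound P → s ≤ u)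

  open RawMonoidDefinitions +-rawMonoid public using (sum)

  -- f 0 + ⋯ + f (j − 1)
  sumBelow : ∀ {n} → Vector Carrier n → Fin n → Carrier
  sumBelow f j = sum {_} (λ (i : Fin′ j) → f (inject i))

-- Simple graphs on a subset of V.  Only the instances of Adj between two
-- elements of Vertex are edges, so that restricting Vertex gives the induced
-- subgraph.
record Graph (V : Set) : Set₁ where
  field
    Vertex     : Pred V 0ℓ
    Adj        : Rel V 0ℓ
    Adj-sym    : Symmetric Adj
    Adj-irrefl : ∀ x → ¬ Adj x x

  Edge : Rel V 0ℓ
  Edge x y = x ∈ Vertex × y ∈ Vertex × Adj x y

  Connected : Set
  Connected = ∀ x y → x ∈ Vertex → y ∈ Vertex → Star Edge x y

  -- The closed walk x, xs, x with pairwise distinct vertices x ∷ xs.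
  IsCycle : V → List V → Set
  IsCycle x xs = 2 ℕ.≤ length xs × Unique (x ∷ xs) × Linked Edge (x ∷ xs ++ [ x ])

  Acyclic : Set
  Acyclic = ∀ x xs → ¬ IsCycle x xs

  IsTree : Set
  IsTree = ∃ Vertex × Connected × Acyclic

induced : ∀ {V} → Graph V → Pred V 0ℓ → Graph V
induced G P = record
  { Vertex     = λ x → x ∈ Vertex × x ∈ P
  ; Adj        = Adj
  ; Adj-sym    = Adj-sym
  ; Adj-irrefl = Adj-irrefl
  } where open Graph G

IsDisjointUnionOfTwoTrees : ∀ {V} → Graph V → Set
IsDisjointUnionOfTwoTrees {V} G =
  ∃ λ (part : V → Bool) →
    (∀ x y → Graph.Edge G x y → part x ≡ part y) ×
    (∀ b → Graph.IsTree (induced G (λ x → part x ≡ b)))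

module _ {A : Set} where

  Language : Set₁
  Language = Pred (List A) 0ℓ

  module _ (S : Language) where

    LeftExt : List A → Pred A 0ℓ
    LeftExt w a = a ∷ w ∈ S

    RightExt : List A → Pred A 0ℓ
    RightExt w b = w ∷ʳ b ∈ S

    BiExt : List A → A → A → Set
    BiExt w a b = a ∷ w ∷ʳ b ∈ S

    Factorial : Set
    Factorial = (∀ a → [ a ] ∈ S) × (∀ u v w → u ++ v ++ w ∈ S → v ∈ S)

    Biextendable : Set
    Biextendable = Factorial × (∀ w → w ∈ S → ∃ λ a → ∃ λ b → BiExt w a b)

    -- inj₁ carries the vertices from L(w), inj₂ those from R(w).
    extensionGraph : List A → Graph (A ⊎ A)
    extensionGraph w = record
      { Vertex     = [ LeftExt w , RightExt w ]′
      ; Adj        = adj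
      ; Adj-sym    = λ {x} {y} → adj-sym x y
      ; Adj-irrefl = adj-irrefl
      }
      where
      adj : Rel (A ⊎ A) 0ℓ
      adj (inj₁ a) (inj₂ b) = BiExt w a b
      adj (inj₂ b) (inj₁ a) = BiExt w a b
      adj (inj₁ _) (inj₁ _) = ⊥
      adj (inj₂ _) (inj₂ _) = ⊥

      adj-sym : ∀ x y → adj x y → adj y x
      adj-sym (inj₁ a) (inj₂ b) e = e
      adj-sym (inj₂ b) (inj₁ a) e = e

      adj-irrefl : ∀ x → ¬ adj x x
      adj-irrefl (inj₁ _) ()
      adj-irrefl (inj₂ _) ()

    TreeSetOfCharacteristic2 : Set
    TreeSetOfCharacteristic2 =
      Biextendable ×
      (∀ w → w ∈ S → w ≢ [] → Graph.IsTree (extensionGraph w)) ×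
      IsDisjointUnionOfTwoTrees (extensionGraph [])

  module _ (θ : A → A) where

    Reduced : Pred (List A) 0ℓ
    Reduced w = ∀ u a v → w ≢ u ++ a ∷ θ a ∷ v

    inverse : List A → List A
    inverse w = reverse (map θ w)

    Specular : Language → Set
    Specular S =
      Biextendable S ×
      (∀ w → w ∈ S → w ∈ Reduced) ×
      (∀ w → w ∈ S → inverse w ∈ S) ×
      TreeSetOfCharacteristic2 S

-- The generalized permutation π of type (ℓ , m), the interval I = (left , right)
-- and the length vector.  The bijection π makes A finite, with ℓ + m elements.
record LengthData (ℝ : Reals) (A : Set) (θ : A → A) : Set where
  open Reals ℝ
  field
    ℓ m         : ℕ
    π           : Fin (ℓ ℕ.+ m) ↔ A
    left right  : Carrier
    left<right  : left < right
    len         : A → Carrier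
    len-pos     : ∀ a → 0# < len a
    len-θ       : ∀ a → len (θ a) ≈ len a

  topLen : Vector Carrier ℓ
  topLen i = len (Inverse.to π (i ↑ˡ m))

  bottomLen : Vector Carrier m
  bottomLen i = len (Inverse.to π (ℓ ↑ʳ i))

  field
    topLen-sum    : sum topLen ≈ right - left
    bottomLen-sum : sum bottomLen ≈ right - left

  -- The second coordinate is false for I × {0} and true for I × {1}.
  Point : Set
  Point = Carrier × Bool

  infix 4 _≈ₚ_
  _≈ₚ_ : Rel Point 0ℓ
  (x , δ) ≈ₚ (y , ε) = x ≈ y × δ ≡ ε

  Î : Pred Point 0ℓ
  Î (x , _) = left < x × x < right

  row : A → Bool
  row a = [ (λ _ → false) , (λ _ → true) ]′ (splitAt ℓ (Inverse.from π a))

  lower : A → Carrier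
  lower a = left + [ sumBelow topLen , sumBelow bottomLen ]′ (splitAt ℓ (Inverse.from π a))

  upper : A → Carrier
  upper a = lower a + len a

  Interval : A → Pred Point 0ℓ
  Interval a (x , δ) = δ ≡ row a × lower a < x × x < upper a

  -- The division points of a component are the left endpoints of its intervals,
  -- except that of the first one, which is the only one outside Î.
  Σ : Pred Point 0ℓ
  Σ p = p ∈ Î × ∃ λ a → p ≈ₚ (lower a , row a)

  Î∖Σ : Pred Point 0ℓ
  Î∖Σ p = p ∈ Î × p ∉ Σ

  σ₂ : Point → Point
  σ₂ (x , δ) = x , not δ

  σ₂-image : Pred Point 0ℓ → Pred Point 0ℓ
  σ₂-image P q = ∃ λ p → p ∈ P × q ≈ₚ σ₂ p

  module _ (f : Point → Point) where

    MapsOnto : Pred Point 0ℓ → Pred Point 0ℓ → Set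
    MapsOnto P Q = (∀ p → p ∈ P → f p ∈ Q) × (∀ q → q ∈ Q → ∃ λ p → p ∈ P × f p ≈ₚ q)

    TranslationOn : Pred Point 0ℓ → Set
    TranslationOn P = ∃ λ c → ∀ p → p ∈ P → proj₁ (f p) ≈ proj₁ p + c

    SymmetryOn : Pred Point 0ℓ → Set
    SymmetryOn P = ∃ λ c → ∀ p → p ∈ P → proj₁ (f p) ≈ c - proj₁ p

-- σ₁ is a map on Î∖Σ only: its values elsewhere are unconstrained, and every
-- notion below uses σ₁ p only for p in Î∖Σ.
record LinearInvolution (ℝ : Reals) (A : Set) (θ : A → A) : Set where
  field
    lengthData : LengthData ℝ A θ
  open LengthData lengthData public
  field
    σ₁            : Point → Point
    σ₁-involutive : ∀ p → p ∈ Î∖Σ → σ₁ (σ₁ p) ≈ₚ p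
    σ₁-onto       : ∀ a → MapsOnto σ₁ (Interval a) (Interval (θ a))
    σ₁-isometry   : ∀ a → TranslationOn σ₁ (Interval a) ⊎ SymmetryOn σ₁ (Interval a)

  T : Point → Point
  T = σ₂ ∘ σ₁

  -- T^[ n ] x ↦ y : the n-th iterate of the partial map T, of domain Î∖Σ, is
  -- defined at x and equal to y.
  T^[_]_↦_ : ℕ → Point → Point → Set
  T^[ zero  ] x ↦ y = x ≈ₚ y
  T^[ suc n ] x ↦ y = x ∈ Î∖Σ × T^[ n ] (T x) ↦ y

  Connection : Point → Point → ℕ → Set
  Connection x y n = x ∈ σ₂-image Σ × y ∈ Σ × T^[ n ] x ↦ y

  WithoutConnections : Set
  WithoutConnections = ∀ x y n → ¬ Connection x y n

  O : Pred Point 0ℓ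
  O z = ∃ λ n → ∃ λ y → y ∈ Σ × T^[ n ] z ↦ y

  Ô : Pred Point 0ℓ
  Ô z = z ∈ O ⊎ z ∈ σ₂-image O

  IsInfiniteCoding : Point → (ℕ → A) → Set
  IsInfiniteCoding z u = ∀ n → ∃ λ y → T^[ n ] z ↦ y × y ∈ Interval (u n)

  naturalCoding : Language {A}
  naturalCoding w =
    ∃ λ z → ∃ λ u → z ∈ Î × z ∉ Ô × IsInfiniteCoding z u ×
      ∃ λ i → ∃ λ n → w ≡ applyUpTo (λ j → u (i ℕ.+ j)) n

{-# OPTIONS --safe #-}
module Submission where

-- Let I_w be the set of the points whose T-orbit starts in I_{a₁}, I_{a₂}, … for
-- w = a₁a₂⋯.  It is an open interval on which T^|w| is an isometry, and by a Baire
-- argument it contains points outside Ô as soon as it is nonempty, so w lies in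
-- the natural coding if and only if I_w is nonempty.  Such words are reduced
-- because T(I_a) and I_{a⁻¹} lie in different components, and the set is closed
-- under inverses because σ₂ T σ₂ = T⁻¹.
--
-- In the extension graph of w, attach to the left letter a the interval
-- I_w ∩ σ₂(I_{a⁻¹}) and to the right letter b the interval I_{wb}.  Two letters
-- are adjacent exactly when their intervals meet, and intervals on the same side
-- are disjoint.  A point of I_w covered by none would be a point of σ₂(Σ) mapped
-- into Σ by T^|w|, that is a connection; so the intervals form an open cover of
-- the connected set I_w, and the graph is connected.  A cycle is impossible: the
-- interval with the smallest supremum would have two neighbours reaching beyond
-- it, which then meet each other.  For w = ε the two components of Î give one
-- tree each.

open import Defs
open import Algebra.Definitions using (Involutive)
open import Axiom.ExcludedMiddle using (ExcludedMiddle)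
open import Data.Bool using (Bool; true; false; not)
open import Data.Bool.Properties using (not-¬; not-involutive)
open import Data.Fin as Fin using (zero; suc; splitAt; _↑ˡ_; _↑ʳ_)
open import Data.Fin.Properties using (<-cmp; splitAt-↑ˡ; splitAt-↑ʳ; splitAt⁻¹-↑ˡ; splitAt⁻¹-↑ʳ)
open import Data.List using (List; []; _∷_; [_]; _++_; _∷ʳ_; map; length; applyUpTo; _ʳ++_)
open import Data.List.Relation.Unary.All using (All; []; _∷_)
open import Data.List.Relation.Unary.AllPairs using ([]; _∷_)
open import Data.List.Relation.Unary.Linked using (Linked; _∷_)
open import Data.List.Relation.Unary.Unique.Propositional using (Unique)
open import Data.Nat as ℕ using (ℕ; zero; suc)
import Data.Nat.Properties as ℕ
open import Data.Product using (∃; _×_; _,_; proj₁; proj₂)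
open import Data.Sum using (_⊎_; inj₁; inj₂; [_,_]′)
open import Data.Vec.Functional using (Vector)
open import Function using (_∘_; id; Inverse)
open import Level using (0ℓ)
open import Relation.Binary.Construct.Closure.ReflexiveTransitive using (Star; ε; _◅_; _◅◅_)
open import Relation.Binary.Definitions using (tri<; tri≈; tri>)
open import Relation.Binary.PropositionalEquality as ≡ using (_≡_; _≢_)
open import Relation.Binary.Structures using (IsStrictTotalOrder)
open import Relation.Nullary using (¬_; yes; no; contradiction)
open import Relation.Unary using (Pred; _∈_; _∉_)
import Algebra.Properties.Group as GroupProperties

-- Graphs: replacing the vertex set, and a criterion for acyclicity

withVertices : ∀ {V} → Graph V → Pred V 0ℓ → Graph V
withVertices G X = record
  { Vertex     = X
  ; Adj        = Adj
  ; Adj-sym    = λ {x} {y} → Adj-sym {x} {y}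
  ; Adj-irrefl = Adj-irrefl
  } where open Graph G

module Acyclicity {V : Set} (G : Graph V) (_≼_ : V → V → Set)
  (≼-total : ∀ u v → u ≼ v ⊎ v ≼ u)
  (≼-trans : ∀ {u v w} → u ≼ v → v ≼ w → u ≼ w)
  (unique-above : ∀ {v u u′} → Graph.Edge G v u → Graph.Edge G v u′ → v ≼ u → v ≼ u′ → u ≡ u′)
  where

  open Graph G

  Edge-sym : ∀ {u v} → Edge u v → Edge v u
  Edge-sym (p , q , e) = q , p , Adj-sym e

  lastOf : V → List V → V
  lastOf a []      = a
  lastOf _ (b ∷ l) = lastOf b l

  lastOf-All : ∀ {P : Pred V 0ℓ} a l → All P (a ∷ l) → P (lastOf a l)
  lastOf-All a []      (p ∷ _)  = p
  lastOf-All _ (b ∷ l) (_ ∷ ps) = lastOf-All b l ps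

  lastOf-edge : ∀ {x} a l → Linked Edge (a ∷ l ++ [ x ]) → Edge (lastOf a l) x
  lastOf-edge a []      (e ∷ _)  = e
  lastOf-edge _ (b ∷ l) (_ ∷ es) = lastOf-edge b l es

  continue-down : ∀ {a b c} → Edge a b → Edge b c → a ≢ c → b ≼ a → c ≼ b
  continue-down {a} {b} {c} ab bc a≢c b≼a with ≼-total b c
  ... | inj₁ b≼c = contradiction (unique-above (Edge-sym ab) bc b≼a b≼c) a≢c
  ... | inj₂ c≼b = c≼b

  -- A vertex has at most one neighbour above it, so a path that goes down once
  -- goes down until its end.
  down : ∀ {x} a b l → Linked Edge (a ∷ b ∷ l ++ [ x ]) → Unique (a ∷ b ∷ l) →
         All (x ≢_) (a ∷ b ∷ l) → b ≼ a → x ≼ b × x ≼ lastOf b l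
  down a b [] (ab ∷ bx ∷ _) _ (x≢a ∷ _) b≼a =
    let x≼b = continue-down ab bx (x≢a ∘ ≡.sym) b≼a in x≼b , x≼b
  down a b (c ∷ l) (ab ∷ es@(bc ∷ _)) ((_ ∷ a≢c ∷ _) ∷ uniq) (_ ∷ x∉) b≼a =
    let c≼b = continue-down ab bc a≢c b≼a
        x≼c , x≼p = down b c l es uniq x∉ c≼b
    in ≼-trans x≼c c≼b , x≼p

  -- Once a step goes down, `down` carries the descent through to `x`, which closes the walk; until
  -- then every step goes up.
  down-or-up : ∀ {x} a l → Linked Edge (a ∷ l ++ [ x ]) → Unique (a ∷ l) →
               All (x ≢_) (a ∷ l) → x ≼ lastOf a l ⊎ a ≼ x
  down-or-up {x} a [] _ _ _ = ≼-total x a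
  down-or-up a (b ∷ l) es@(_ ∷ es′) uniq@(_ ∷ uniq′) x∉@(_ ∷ x∉′) with ≼-total b a
  ... | inj₁ b≼a = inj₁ (proj₂ (down a b l es uniq x∉ b≼a))
  ... | inj₂ a≼b with down-or-up b l es′ uniq′ x∉′
  ...   | inj₁ x≼p = inj₁ x≼p
  ...   | inj₂ b≼x = inj₂ (≼-trans a≼b b≼x)

  -- In a cycle `x`, `a`, `b`, ...: if `a ≼ x`, the walk descends all the way round, so `x ≼ b` and
  -- `a` has two neighbours `x` and `b` above it. If `x ≼ a`, either `x` has both `a` and the last
  -- vertex above it, or the walk never goes down and the first case applies.
  acyclic : Acyclic
  acyclic x []           (() , _)
  acyclic x (_ ∷ [])     (ℕ.s≤s () , _)
  acyclic x (a ∷ b ∷ l) (_ , (x∉@(_ ∷ x≢b ∷ _) ∷ uniq@(a∉ ∷ _)) , xa ∷ es@(ab ∷ es′)) =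
    [ a⋠x , x⋠a ]′ (≼-total a x)
    where
    a⋠x : ¬ a ≼ x
    a⋠x a≼x = x≢b (unique-above (Edge-sym xa) ab a≼x (≼-trans a≼x x≼b))
      where
      x≼b : x ≼ b
      x≼b = proj₁ (down a b l es uniq x∉ (continue-down xa ab x≢b a≼x))

    x⋠a : ¬ x ≼ a
    x⋠a x≼a with down-or-up a (b ∷ l) es uniq x∉
    ... | inj₁ x≼p = lastOf-All b l a∉
                       (unique-above xa (Edge-sym (lastOf-edge b l es′)) x≼a x≼p)
    ... | inj₂ a≼x = a⋠x a≼x

-- Order and arithmetic of the real line

module RealLine (ℝ : Reals) where

  open Reals ℝ hiding (zero)
  open IsStrictTotalOrder isStrictTotalOrder public
    using (compare; _<?_; <-respʳ-≈; <-respˡ-≈; asym; irrefl)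
    renaming (trans to <-trans)
  open GroupProperties +-group using (//-rightDividesˡ; //-rightDividesʳ; ⁻¹-anti-homo-//)

  <-≤-trans : ∀ {x y z} → x < y → y ≤ z → x < z
  <-≤-trans {x} {y} {z} x<y y≤z with compare x z
  ... | tri< x<z _ _ = x<z
  ... | tri≈ _ x≈z _ = contradiction (<-respˡ-≈ x≈z x<y) y≤z
  ... | tri> _ _ z<x = contradiction (<-trans z<x x<y) y≤z

  ≤-<-trans : ∀ {x y z} → x ≤ y → y < z → x < z
  ≤-<-trans {x} {y} {z} x≤y y<z with compare x z
  ... | tri< x<z _ _ = x<z
  ... | tri≈ _ x≈z _ = contradiction (<-respʳ-≈ (sym x≈z) y<z) x≤y
  ... | tri> _ _ z<x = contradiction (<-trans y<z z<x) x≤y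

  ≤-trans : ∀ {x y z} → x ≤ y → y ≤ z → x ≤ z
  ≤-trans x≤y y≤z z<x = x≤y (≤-<-trans y≤z z<x)

  <⇒≤ : ∀ {x y} → x < y → x ≤ y
  <⇒≤ = asym

  ≤-reflexive : ∀ {x y} → x ≈ y → x ≤ y
  ≤-reflexive x≈y = irrefl (sym x≈y)

  ≤-total : ∀ x y → x ≤ y ⊎ y ≤ x
  ≤-total x y with y <? x
  ... | yes y<x = inj₂ (<⇒≤ y<x)
  ... | no  x≤y = inj₁ x≤y

  +-monoʳ-< : ∀ z {x y} → x < y → z + x < z + y
  +-monoʳ-< z {x} {y} x<y = <-respˡ-≈ (+-comm x z) (<-respʳ-≈ (+-comm y z) (+-monoˡ-< z x<y))

  x<x+y : ∀ x {y} → 0# < y → x < x + y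
  x<x+y x 0<y = <-respˡ-≈ (+-identityʳ x) (+-monoʳ-< x 0<y)

  -‿anti-< : ∀ z {x y} → x < y → z - y < z - x
  -‿anti-< z {x} {y} x<y = +-monoʳ-< z
    (<-respˡ-≈ (cancel x y) (<-respʳ-≈ (trans (+-congˡ (+-comm (- x) (- y))) (cancel y x))
      (+-monoˡ-< (- x + - y) x<y)))
    where
    cancel : ∀ a b → a + (- a + - b) ≈ - b
    cancel a b = trans (sym (+-assoc a (- a) (- b)))
                   (trans (+-congʳ (-‿inverseʳ a)) (+-identityˡ (- b)))

  z-[z-x]≈x : ∀ z x → z - (z - x) ≈ x
  z-[z-x]≈x z x = trans (+-congˡ (⁻¹-anti-homo-// z x))
    (trans (+-comm z (x - z)) (//-rightDividesˡ z x))

  -- Since `0 < 1 < 1 + 1`, the element `1 + 1` is nonzero, hence invertible; this gives midpoints.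
  half : ∃ λ h → (1# + 1#) * h ≈ 1#
  half = *-inverse (1# + 1#) λ 2≈0 →
    irrefl (sym 2≈0) (<-trans 0<1 (x<x+y 1# 0<1))

  mid : Carrier → Carrier → Carrier
  mid x y = (x + y) * proj₁ half

  mid-double : ∀ x y → mid x y + mid x y ≈ x + y
  mid-double x y =
    trans (sym (distribˡ (x + y) h h))
      (trans (*-congˡ (trans (sym (+-cong (*-identityˡ h) (*-identityˡ h)))
        (trans (sym (distribʳ h 1# 1#)) (proj₂ half))))
      (*-identityʳ (x + y)))
    where
    h = proj₁ half

  +-mono-≤ : ∀ {x y u v} → x ≤ y → u ≤ v → x + u ≤ y + v
  +-mono-≤ {x} {y} {u} {v} x≤y u≤v y+v<x+u with compare x y | compare u v
  ... | tri> _ _ y<x | _ = x≤y y<x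
  ... | _ | tri> _ _ v<u = u≤v v<u
  ... | tri< x<y _ _ | tri< u<v _ _ =
        asym y+v<x+u (<-trans (+-monoˡ-< u x<y) (+-monoʳ-< y u<v))
  ... | tri< x<y _ _ | tri≈ _ u≈v _ =
        asym y+v<x+u (<-respʳ-≈ (+-congˡ u≈v) (+-monoˡ-< u x<y))
  ... | tri≈ _ x≈y _ | tri< u<v _ _ =
        asym y+v<x+u (<-respʳ-≈ (+-congʳ x≈y) (+-monoʳ-< x u<v))
  ... | tri≈ _ x≈y _ | tri≈ _ u≈v _ = irrefl (sym (+-cong x≈y u≈v)) y+v<x+u

  -- The midpoint works: on the wrong side of `x` or `y`, its double could not be `x + y`.
  dense : ∀ {x y} → x < y → ∃ λ z → x < z × z < y
  dense {x} {y} x<y = mid x y , x<mid , mid<y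
    where
    x<mid : x < mid x y
    x<mid with x <? mid x y
    ... | yes p = p
    ... | no mid≤x = contradiction
            (<-respʳ-≈ (sym (mid-double x y)) (+-monoʳ-< x x<y)) (+-mono-≤ mid≤x mid≤x)

    mid<y : mid x y < y
    mid<y with mid x y <? y
    ... | yes p = p
    ... | no y≤mid = contradiction
            (<-respˡ-≈ (sym (mid-double x y)) (+-monoˡ-< y x<y)) (+-mono-≤ y≤mid y≤mid)

  dense² : ∀ {x y z} → x < y → x < z → ∃ λ t → x < t × t < y × t < z
  dense² {x} {y} {z} x<y x<z with ≤-total y z
  ... | inj₁ y≤z = let t , x<t , t<y = dense x<y in t , x<t , t<y , <-≤-trans t<y y≤z
  ... | inj₂ z≤y = let t , x<t , t<z = dense x<z in t , x<t , <-≤-trans t<z z≤y , t<z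

  -- Consecutive intervals with given lengths

  -- The starting point `s` is arbitrary so that the induction can move it past the first interval
  -- when `x` is not in it.
  sum-locate : ∀ {n} (f : Vector Carrier n) s x → s ≤ x → x < s + sum f →
               ∃ λ j → s + sumBelow f j ≤ x × x < s + sumBelow f j + f j
  sum-locate {zero}  f s x s≤x x<s+0 = contradiction (<-respʳ-≈ (+-identityʳ s) x<s+0) s≤x
  sum-locate {suc n} f s x s≤x x<s+Σ with x <? (s + f zero)
  ... | yes x<s+f₀ = zero , ≤-trans (≤-reflexive (+-identityʳ s)) s≤x
                   , <-respʳ-≈ (+-congʳ (sym (+-identityʳ s))) x<s+f₀
  ... | no s+f₀≤x =
        let j , p , q = sum-locate (f ∘ suc) (s + f zero) x s+f₀≤x
                          (<-respʳ-≈ (sym (+-assoc s (f zero) _)) x<s+Σ)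
        in suc j , ≤-trans (≤-reflexive (sym (+-assoc s (f zero) _))) p
                 , <-respʳ-≈ (+-congʳ (+-assoc s (f zero) _)) q

  sumBelow-nonneg : ∀ {n} (f : Vector Carrier n) → (∀ i → 0# < f i) →
                    ∀ s j → s ≤ s + sumBelow f j
  sumBelow-nonneg f f-pos s zero    = ≤-reflexive (sym (+-identityʳ s))
  sumBelow-nonneg f f-pos s (suc j) =
    ≤-trans (<⇒≤ (x<x+y s (f-pos zero)))
      (≤-trans (sumBelow-nonneg (f ∘ suc) (f-pos ∘ suc) (s + f zero) j)
        (≤-reflexive (+-assoc s (f zero) _)))

  sumBelow-mono : ∀ {n} (f : Vector Carrier n) → (∀ i → 0# < f i) →
                  ∀ s i j → i Fin.< j → s + sumBelow f i + f i ≤ s + sumBelow f j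
  sumBelow-mono f f-pos s zero (suc j) _ =
    ≤-trans (≤-reflexive (+-congʳ (+-identityʳ s)))
      (≤-trans (sumBelow-nonneg (f ∘ suc) (f-pos ∘ suc) (s + f zero) j)
        (≤-reflexive (+-assoc s (f zero) _)))
  sumBelow-mono f f-pos s (suc i) (suc j) (ℕ.s≤s i<j) =
    ≤-trans (≤-reflexive (+-congʳ (sym (+-assoc s (f zero) _))))
      (≤-trans (sumBelow-mono (f ∘ suc) (f-pos ∘ suc) (s + f zero) i j i<j)
        (≤-reflexive (+-assoc s (f zero) _)))

  sum-nonneg : ∀ {n} (f : Vector Carrier n) → (∀ i → 0# < f i) → ∀ s → s ≤ s + sum f
  sum-nonneg {zero}  f f-pos s = ≤-reflexive (sym (+-identityʳ s))
  sum-nonneg {suc n} f f-pos s =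
    ≤-trans (<⇒≤ (x<x+y s (f-pos zero)))
      (≤-trans (sum-nonneg (f ∘ suc) (f-pos ∘ suc) (s + f zero))
        (≤-reflexive (+-assoc s (f zero) _)))

  sumBelow-≤-sum : ∀ {n} (f : Vector Carrier n) → (∀ i → 0# < f i) →
                   ∀ s j → s + sumBelow f j + f j ≤ s + sum f
  sumBelow-≤-sum f f-pos s zero =
    ≤-trans (≤-reflexive (+-congʳ (+-identityʳ s)))
      (≤-trans (sum-nonneg (f ∘ suc) (f-pos ∘ suc) (s + f zero))
        (≤-reflexive (+-assoc s (f zero) _)))
  sumBelow-≤-sum f f-pos s (suc j) =
    ≤-trans (≤-reflexive (+-congʳ (sym (+-assoc s (f zero) _))))
      (≤-trans (sumBelow-≤-sum (f ∘ suc) (f-pos ∘ suc) (s + f zero) j)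
        (≤-reflexive (+-assoc s (f zero) _)))

  -- Open and convex sets of reals

  Between : Carrier → Carrier → Pred Carrier 0ℓ
  Between l r x = l < x × x < r

  Respects≈ : Pred Carrier 0ℓ → Set
  Respects≈ P = ∀ {x y} → x ≈ y → P x → P y

  Convex : Pred Carrier 0ℓ → Set
  Convex P = ∀ {x y t} → P x → P y → x < t → t < y → P t

  Open : Pred Carrier 0ℓ → Set
  Open P = ∀ {x} → P x → ∃ λ l → ∃ λ r → Between l r x × (∀ t → Between l r t → P t)

  -- `Convex` speaks of strict inequalities only; an endpoint attained up to `_≈_` is settled by
  -- `Respects≈`.
  Convex-≤ : ∀ {P} → Respects≈ P → Convex P → ∀ {x y t} → P x → P y → x ≤ t → t ≤ y → P t
  Convex-≤ resp conv {x} {y} {t} px py x≤t t≤y with compare x t | compare t y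
  ... | tri> _ _ t<x | _ = contradiction t<x x≤t
  ... | _ | tri> _ _ y<t = contradiction y<t t≤y
  ... | tri≈ _ x≈t _ | _ = resp x≈t px
  ... | _ | tri≈ _ t≈y _ = resp (sym t≈y) py
  ... | tri< x<t _ _ | tri< t<y _ _ = conv px py x<t t<y

  Between-resp : ∀ l r → Respects≈ (Between l r)
  Between-resp l r x≈y (l<x , x<r) = <-respʳ-≈ x≈y l<x , <-respˡ-≈ x≈y x<r

  Between-open : ∀ l r → Open (Between l r)
  Between-open l r x∈ = l , r , x∈ , λ _ t∈ → t∈

  Between-convex : ∀ l r → Convex (Between l r)
  Between-convex l r (l<x , _) (_ , y<r) x<t t<y = <-trans l<x x<t , <-trans t<y y<r

  ∩-open : ∀ {P Q} → Open P → Open Q → Open (λ x → P x × Q x)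
  ∩-open openP openQ {x} (px , qx)
    with openP px | openQ qx
  ... | l , r , (l<x , x<r) , sub | l′ , r′ , (l′<x , x<r′) , sub′ =
    let r″ , x<r″ , r″<r , r″<r′ = dense² x<r x<r′
        l″ , l≤l″ , l′≤l″ , l″<x = max
    in l″ , r″ , (l″<x , x<r″) , λ t (l″<t , t<r″) →
         sub t (≤-<-trans l≤l″ l″<t , <-trans t<r″ r″<r) ,
         sub′ t (≤-<-trans l′≤l″ l″<t , <-trans t<r″ r″<r′)
    where
    max : ∃ λ l″ → l ≤ l″ × l′ ≤ l″ × l″ < x
    max with ≤-total l l′
    ... | inj₁ l≤l′ = l′ , l≤l′ , ≤-reflexive refl , l′<x
    ... | inj₂ l′≤l = l , ≤-reflexive refl , l′≤l , l<x

  -- Translations and symmetries of the line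

  Increasing Decreasing : (Carrier → Carrier) → Set
  Increasing f = ∀ {x y} → x < y → f x < f y
  Decreasing f = ∀ {x y} → x < y → f y < f x

  -- What translations and symmetries have in common: a monotone bijection with an explicit inverse.
  -- `monotone` also records the inverse, so that `inverseMotion` merely exchanges the fields.
  record Motion : Set where
    field
      to from   : Carrier → Carrier
      to-cong   : ∀ {x y} → x ≈ y → to x ≈ to y
      from-cong : ∀ {x y} → x ≈ y → from x ≈ from y
      to∘from   : ∀ x → to (from x) ≈ x
      from∘to   : ∀ x → from (to x) ≈ x
      monotone  : (Increasing to × Increasing from) ⊎ (Decreasing to × Decreasing from)

    -- The endpoints are pulled back by `from`, and change places when the motion reverses
    -- orientation.
    preimage-Between : ∀ l r → ∃ λ l′ → ∃ λ r′ →
      (∀ x → Between l r (to x) → Between l′ r′ x) × (∀ x → Between l′ r′ x → Between l r (to x))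
    preimage-Between l r with monotone
    ... | inj₁ (to-mono , from-mono) = from l , from r ,
          (λ x (p , q) → <-respʳ-≈ (from∘to x) (from-mono p) , <-respˡ-≈ (from∘to x) (from-mono q)) ,
          (λ x (p , q) → <-respˡ-≈ (to∘from l) (to-mono p) , <-respʳ-≈ (to∘from r) (to-mono q))
    ... | inj₂ (to-anti , from-anti) = from r , from l ,
          (λ x (p , q) → <-respʳ-≈ (from∘to x) (from-anti q) , <-respˡ-≈ (from∘to x) (from-anti p)) ,
          (λ x (p , q) → <-respˡ-≈ (to∘from l) (to-anti q) , <-respʳ-≈ (to∘from r) (to-anti p))

    preimage-open : ∀ {P} → Open P → Open (P ∘ to)
    preimage-open openP {x} ptx =
      let l , r , tx∈ , sub = openP ptx
          l′ , r′ , f , g = preimage-Between l r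
      in l′ , r′ , f x tx∈ , λ t t∈ → sub (to t) (g t t∈)

    preimage-convex : ∀ {P} → Convex P → Convex (P ∘ to)
    preimage-convex convP px py x<t t<y with monotone
    ... | inj₁ (to-mono , _) = convP px py (to-mono x<t) (to-mono t<y)
    ... | inj₂ (to-anti , _) = convP py px (to-anti t<y) (to-anti x<t)

  translation : Carrier → Motion
  translation c = record
    { to        = _+ c
    ; from      = _- c
    ; to-cong   = +-congʳ
    ; from-cong = +-congʳ
    ; to∘from   = //-rightDividesˡ c
    ; from∘to   = //-rightDividesʳ c
    ; monotone  = inj₁ (+-monoˡ-< c , +-monoˡ-< (- c))
    }

  symmetry : Carrier → Motion
  symmetry c = record
    { to        = λ x → c - x
    ; from      = λ x → c - x
    ; to-cong   = λ x≈y → +-congˡ (-‿cong x≈y)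
    ; from-cong = λ x≈y → +-congˡ (-‿cong x≈y)
    ; to∘from   = z-[z-x]≈x c
    ; from∘to   = z-[z-x]≈x c
    ; monotone  = inj₂ (-‿anti-< c , -‿anti-< c)
    }

  inverseMotion : Motion → Motion
  inverseMotion μ = record
    { to        = from
    ; from      = to
    ; to-cong   = from-cong
    ; from-cong = to-cong
    ; to∘from   = from∘to
    ; from∘to   = to∘from
    ; monotone  = from-monotone
    }
    where
    open Motion μ
    from-monotone : (Increasing from × Increasing to) ⊎ (Decreasing from × Decreasing to)
    from-monotone with monotone
    ... | inj₁ (p , q) = inj₁ (q , p)
    ... | inj₂ (p , q) = inj₂ (q , p)

  -- Baire's theorem for intervals

  -- Stronger than density of `P`: inside `J`, it is the interior of `P` that is dense. This form is
  -- stable under finite intersections and is what the nested intervals below require.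
  DenseIn : Pred Carrier 0ℓ → Pred Carrier 0ℓ → Set
  DenseIn J P = ∀ {l r} → l < r → (∀ x → Between l r x → J x) →
    ∃ λ l′ → ∃ λ r′ → l′ < r′ × (∀ x → Between l′ r′ x → Between l r x × P x)

  DenseIn-∩ : ∀ {J P Q} → DenseIn J P → DenseIn J Q → DenseIn J (λ x → P x × Q x)
  DenseIn-∩ denseP denseQ l<r sub =
    let l₁ , r₁ , l₁<r₁ , sub₁ = denseP l<r sub
        l₂ , r₂ , l₂<r₂ , sub₂ = denseQ l₁<r₁ (λ x x∈ → sub x (proj₁ (sub₁ x x∈)))
    in l₂ , r₂ , l₂<r₂ , λ x x∈ →
         let x∈₁ , qx = sub₂ x x∈
             x∈₀ , px = sub₁ x x∈₁
         in x∈₀ , px , qx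

  module Baire {J : Pred Carrier 0ℓ} (P : ℕ → Pred Carrier 0ℓ) (P-dense : ∀ n → DenseIn J (P n))
    where

    record Box : Set where
      field
        lo hi : Carrier
        lo<hi : lo < hi
        inJ   : ∀ x → Between lo hi x → J x

    open Box

    -- The new box is chosen with its closure inside the open interval given by density, so that a
    -- limit of endpoints still lies in `P n` and strictly inside `B`.
    shrink : ∀ n (B : Box) → ∃ λ (B′ : Box) →
      lo B < lo B′ × hi B′ < hi B × (∀ x → lo B′ ≤ x → x ≤ hi B′ → P n x)
    shrink n B =
      let l , r , l<r , sub = P-dense n (lo<hi B) (inJ B)
          c , l<c , c<r     = dense l<r
          l′ , l<l′ , l′<c  = dense l<c
          r′ , c<r′ , r′<r  = dense c<r
          l′<r′             = <-trans l′<c c<r′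
      in record
           { lo    = l′
           ; hi    = r′
           ; lo<hi = l′<r′
           ; inJ   = λ x (l′<x , x<r′) →
               inJ B x (proj₁ (sub x (<-trans l<l′ l′<x , <-trans x<r′ r′<r)))
           }
         , proj₁ (proj₁ (sub l′ (l<l′ , <-trans l′<r′ r′<r)))
         , proj₂ (proj₁ (sub r′ (<-trans l<l′ l′<r′ , r′<r)))
         , λ x l′≤x x≤r′ → proj₂ (sub x (<-≤-trans l<l′ l′≤x , ≤-<-trans x≤r′ r′<r))

    nested : Box → ℕ → Box
    nested B zero    = B
    nested B (suc n) = proj₁ (shrink n (nested B n))

    module _ (B : Box) where

      lo< : ∀ n → lo (nested B n) < lo (nested B (suc n))
      lo< n = proj₁ (proj₂ (shrink n (nested B n)))

      hi> : ∀ n → hi (nested B (suc n)) < hi (nested B n)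
      hi> n = proj₁ (proj₂ (proj₂ (shrink n (nested B n))))

      lo-mono : ∀ k n → lo (nested B n) ≤ lo (nested B (k ℕ.+ n))
      lo-mono zero    n = ≤-reflexive refl
      lo-mono (suc k) n = ≤-trans (lo-mono k n) (<⇒≤ (lo< (k ℕ.+ n)))

      hi-anti : ∀ k n → hi (nested B (k ℕ.+ n)) ≤ hi (nested B n)
      hi-anti zero    n = ≤-reflexive refl
      hi-anti (suc k) n = ≤-trans (<⇒≤ (hi> (k ℕ.+ n))) (hi-anti k n)

      lo≤hi : ∀ k n → lo (nested B k) ≤ hi (nested B n)
      lo≤hi k n = ≤-trans
        (≡.subst (λ i → lo (nested B k) ≤ lo (nested B i)) (ℕ.+-comm n k) (lo-mono n k))
        (≤-trans (<⇒≤ (lo<hi (nested B (k ℕ.+ n)))) (hi-anti k n))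

      -- The supremum of the left endpoints. Every left endpoint is at most every right endpoint, so
      -- it lies in the closure of each box; the box of index `n + 1` is the one chosen within
      -- `P n`.
      common-point : ∃ λ x → Between (lo B) (hi B) x × (∀ n → P n x)
      common-point
        with complete (λ x → ∃ λ n → x ≈ lo (nested B n)) (lo B , zero , refl)
               (hi B , λ x (n , x≈lo) → ≤-trans (≤-reflexive x≈lo) (lo≤hi n zero))
      ... | x , upper , least =
            x , (<-≤-trans (lo< zero) (x≥lo (suc zero)) , ≤-<-trans (x≤hi (suc zero)) (hi> zero))
              , λ n → proj₂ (proj₂ (proj₂ (shrink n (nested B n)))) x (x≥lo (suc n)) (x≤hi (suc n))
        where
        x≥lo : ∀ n → lo (nested B n) ≤ x
        x≥lo n = upper (lo (nested B n)) (n , refl)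

        x≤hi : ∀ n → x ≤ hi (nested B n)
        x≤hi n = least (hi (nested B n)) λ y (k , y≈lo) → ≤-trans (≤-reflexive y≈lo) (lo≤hi k n)

  baire : ∀ {J} (P : ℕ → Pred Carrier 0ℓ) → (∀ n → DenseIn J (P n)) →
          ∀ {l r} → l < r → (∀ x → Between l r x → J x) →
          ∃ λ x → Between l r x × (∀ n → P n x)
  baire P P-dense l<r sub =
    Baire.common-point P P-dense (record { lo<hi = l<r ; inJ = sub })

  -- Connectedness of convex sets

  -- As `s` and `s′` can be exchanged, near `t` either all points satisfy `Q` or none does.
  LocallyConstantOn : Pred Carrier 0ℓ → Pred Carrier 0ℓ → Set
  LocallyConstantOn J Q = ∀ {t} → J t → ∃ λ l → ∃ λ r →
    Between l r t × (∀ {s s′} → Between l r s → Between l r s′ → Q s → Q s′)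

  module _ (em : ExcludedMiddle 0ℓ) {J : Pred Carrier 0ℓ}
    (J-resp : Respects≈ J) (J-convex : Convex J) where

    -- Let `s` be the supremum of the points of `[x , y]` satisfying `Q`. Some of them lie in the
    -- neighbourhood of `s` where `Q` is constant, so `Q` holds throughout it, which is impossible
    -- beyond `s` unless `s ≈ y`.
    locallyConstant-rise : ∀ {Q} → LocallyConstantOn J Q →
                           ∀ {x y} → x ≤ y → J x → J y → Q x → Q y
    locallyConstant-rise {Q} Q-const {x} {y} x≤y Jx Jy Qx
      with complete (λ t → x ≤ t × t ≤ y × Q t) (x , ≤-reflexive refl , x≤y , Qx)
             (y , λ _ → proj₁ ∘ proj₂)
    ... | s , upper , least
      with Q-const (Convex-≤ J-resp J-convex Jx Jy
             (upper x (≤-reflexive refl , x≤y , Qx)) (least y λ _ → proj₁ ∘ proj₂))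
    ... | l , r , (l<s , s<r) , const with em {∃ λ t → (x ≤ t × t ≤ y × Q t) × l < t}
    ... | no none = contradiction l<s (least l λ t t∈ l<t → none (t , t∈ , l<t))
    ... | yes (t , t∈@(x≤t , _ , Qt) , l<t) with compare s y
    ...   | tri> _ _ y<s = contradiction y<s (least y λ _ → proj₁ ∘ proj₂)
    ...   | tri≈ _ s≈y _ =
            const (l<t , ≤-<-trans (upper t t∈) s<r) (<-respʳ-≈ s≈y l<s , <-respˡ-≈ s≈y s<r) Qt
    ...   | tri< s<y _ _ =
            let s′ , s<s′ , s′<r , s′<y = dense² s<r s<y
                t<r = ≤-<-trans (upper t t∈) s<r
                x≤s′ = ≤-trans x≤t (≤-trans (upper t t∈) (<⇒≤ s<s′))
            in contradiction s<s′ (upper s′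
                 (x≤s′ , <⇒≤ s′<y , const (l<t , t<r) (<-trans l<s s<s′ , s′<r) Qt))

    -- Leftwards, the previous lemma is applied to the negation of `Q`, which is locally constant
    -- too.
    locallyConstant⇒constant : ∀ {Q} → LocallyConstantOn J Q → ∀ {x y} → J x → J y → Q x → Q y
    locallyConstant⇒constant {Q} Q-const {x} {y} Jx Jy Qx with ≤-total x y
    ... | inj₁ x≤y = locallyConstant-rise Q-const x≤y Jx Jy Qx
    ... | inj₂ y≤x with em {Q y}
    ...   | yes Qy = Qy
    ...   | no ¬Qy = contradiction Qx (locallyConstant-rise ¬Q-const y≤x Jy Jx ¬Qy)
      where
      ¬Q-const : LocallyConstantOn J (λ t → ¬ Q t)
      ¬Q-const Jt =
        let l , r , t∈ , const = Q-const Jt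
        in l , r , t∈ , λ s∈ s′∈ ¬Qs Qs′ → ¬Qs (const s′∈ s∈ Qs′)

  -- Intersection graphs of open intervals covering an interval

  module IntersectionGraph (em : ExcludedMiddle 0ℓ) {V : Set} (G : Graph V)
    (J : Pred Carrier 0ℓ) (J-resp : Respects≈ J) (J-convex : Convex J)
    (U : V → Pred Carrier 0ℓ)
    (U-resp : ∀ v → Respects≈ (U v)) (U-convex : ∀ v → Convex (U v)) (U-open : ∀ v → Open (U v))
    (U⊆J : ∀ v {x} → U v x → J x) (cover : ∀ {x} → J x → ∃ λ v → U v x)
    (U⇒Vertex : ∀ {v x} → U v x → Graph.Vertex G v)
    (Vertex⇒U : ∀ {v} → Graph.Vertex G v → ∃ λ x → U v x)
    (meet⇒Adj : ∀ {u v x} → U u x → U v x → u ≡ v ⊎ Graph.Adj G u v)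
    (Edge⇒meet : ∀ {u v} → Graph.Edge G u v → ∃ λ x → U u x × U v x)
    (triangleFree : ∀ {u v w} → Graph.Adj G u v → Graph.Adj G u w → ¬ Graph.Adj G v w)
    where

    open Graph G

    meet⇒Star : ∀ {u v x} → U u x → U v x → Star Edge u v
    meet⇒Star ux vx with meet⇒Adj ux vx
    ... | inj₁ ≡.refl = ε
    ... | inj₂ adj    = (U⇒Vertex ux , U⇒Vertex vx , adj) ◅ ε

    -- Being in the set of some vertex reachable from `u` is a locally constant property of a point:
    -- if it holds at one point of a covering set `U v′`, then `v′` is reachable and it holds on all
    -- of `U v′`.
    connected : Connected
    connected u v u∈ v∈ =
      let x , ux = Vertex⇒U u∈
          y , vy = Vertex⇒U v∈
          w , wy , u⟶w = locallyConstant⇒constant em J-resp J-convex reachable-const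
                           (U⊆J u ux) (U⊆J v vy) (u , ux , ε)
      in u⟶w ◅◅ meet⇒Star wy vy
      where
      Reachable : Pred Carrier 0ℓ
      Reachable t = ∃ λ w → U w t × Star Edge u w

      reachable-const : LocallyConstantOn J Reachable
      reachable-const Jt =
        let v′ , v′t = cover Jt
            l , r , t∈ , sub = U-open v′ v′t
        in l , r , t∈ , λ {s} {s′} s∈ s′∈ (w , ws , u⟶w) →
             v′ , sub s′ s′∈ , (u⟶w ◅◅ meet⇒Star ws (sub s s∈))

    -- sup (U u) ≤ sup (U v)
    _≼_ : V → V → Set
    u ≼ v = ∀ x → U u x → ∃ λ y → U v y × x ≤ y

    ≼-trans : ∀ {u v w} → u ≼ v → v ≼ w → u ≼ w
    ≼-trans u≼v v≼w x ux =
      let y , vy , x≤y = u≼v x ux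
          z , wz , y≤z = v≼w y vy
      in z , wz , ≤-trans x≤y y≤z

    -- Either some point of `U u` bounds `U v` from above, or each point of `U u` is overtaken by
    -- one of `U v`.
    ≼-total : ∀ u v → u ≼ v ⊎ v ≼ u
    ≼-total u v with em {∃ λ x → U u x × (∀ y → U v y → y ≤ x)}
    ... | yes (x , ux , above) = inj₂ λ y vy → x , ux , above y vy
    ... | no none = inj₁ u≼v
      where
      u≼v : u ≼ v
      u≼v x ux with em {∃ λ y → U v y × x ≤ y}
      ... | yes found = found
      ... | no ¬found = contradiction
              (x , ux , λ y vy x<y → ¬found (y , vy , <⇒≤ x<y)) none

    -- If u and u′ meet v at p ≤ p′ and reach above v, then u contains p′ by
    -- convexity, so u and u′ meet.
    unique-above : ∀ {v u u′} → Edge v u → Edge v u′ → v ≼ u → v ≼ u′ → u ≡ u′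
    unique-above {v} {u} {u′} vu@(_ , _ , adj) vu′@(_ , _ , adj′) v≼u v≼u′
      with Edge⇒meet vu | Edge⇒meet vu′
    ... | p , vp , up | p′ , vp′ , u′p′ =
          [ id , (λ a → contradiction a (triangleFree adj adj′)) ]′ meets
      where
      meets : u ≡ u′ ⊎ Adj u u′
      meets with ≤-total p p′
      ... | inj₁ p≤p′ = let y , uy , p′≤y = v≼u p′ vp′ in
              meet⇒Adj (Convex-≤ (U-resp u) (U-convex u) up uy p≤p′ p′≤y) u′p′
      ... | inj₂ p′≤p = let y , u′y , p≤y = v≼u′ p vp in
              meet⇒Adj up (Convex-≤ (U-resp u′) (U-convex u′) u′p′ u′y p′≤p p≤y)

    isTree : ∃ J → IsTree
    isTree (x , Jx) =
      let v , vx = cover Jx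
      in (v , U⇒Vertex vx) , connected , Acyclicity.acyclic G _≼_ ≼-total ≼-trans unique-above

-- The intervals of the generalized permutation

module Geometry {ℝ : Reals} {A : Set} {θ : A → A} (D : LengthData ℝ A θ) where

  open Reals ℝ hiding (zero)
  open RealLine ℝ
  open LengthData D
  open GroupProperties +-group using (//-rightDividesˡ)

  -- A view of letters as places of the generalized permutation. Matching on it, then rewriting with
  -- `splitAt-top` or `splitAt-bottom`, lets `row` and `lower` compute.
  data Position : A → Set where
    top    : ∀ i → Position (Inverse.to π (i ↑ˡ m))
    bottom : ∀ i → Position (Inverse.to π (ℓ ↑ʳ i))

  position : ∀ a → Position a
  position a with splitAt ℓ (Inverse.from π a) in eq
  ... | inj₁ i = ≡.subst Position
                   (≡.trans (≡.cong (Inverse.to π) (splitAt⁻¹-↑ˡ eq)) (Inverse.strictlyInverseˡ π a))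
                   (top i)
  ... | inj₂ i = ≡.subst Position
                   (≡.trans (≡.cong (Inverse.to π) (splitAt⁻¹-↑ʳ eq)) (Inverse.strictlyInverseˡ π a))
                   (bottom i)

  splitAt-top : ∀ i → splitAt ℓ (Inverse.from π (Inverse.to π (i ↑ˡ m))) ≡ inj₁ i
  splitAt-top i rewrite Inverse.strictlyInverseʳ π (i ↑ˡ m) = splitAt-↑ˡ ℓ i m

  splitAt-bottom : ∀ i → splitAt ℓ (Inverse.from π (Inverse.to π (ℓ ↑ʳ i))) ≡ inj₂ i
  splitAt-bottom i rewrite Inverse.strictlyInverseʳ π (ℓ ↑ʳ i) = splitAt-↑ʳ ℓ m i

  left+sum : ∀ {s} → s ≈ right - left → left + s ≈ right
  left+sum s≈ = trans (+-congˡ s≈) (trans (+-comm left _) (//-rightDividesˡ left right))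

  topLen-pos : ∀ i → 0# < topLen i
  topLen-pos i = len-pos _

  bottomLen-pos : ∀ i → 0# < bottomLen i
  bottomLen-pos i = len-pos _

  left≤lower : ∀ a → left ≤ lower a
  left≤lower a with position a
  ... | top i    rewrite splitAt-top i    = sumBelow-nonneg topLen topLen-pos left i
  ... | bottom i rewrite splitAt-bottom i = sumBelow-nonneg bottomLen bottomLen-pos left i

  upper≤right : ∀ a → upper a ≤ right
  upper≤right a with position a
  ... | top i    rewrite splitAt-top i    =
        ≤-trans (sumBelow-≤-sum topLen topLen-pos left i) (≤-reflexive (left+sum topLen-sum))
  ... | bottom i rewrite splitAt-bottom i =
        ≤-trans (sumBelow-≤-sum bottomLen bottomLen-pos left i) (≤-reflexive (left+sum bottomLen-sum))

  separated : ∀ a b → row a ≡ row b → a ≡ b ⊎ (upper a ≤ lower b ⊎ upper b ≤ lower a)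
  separated a b eq with position a | position b
  separated _ _ eq | top i | top j rewrite splitAt-top i | splitAt-top j with <-cmp i j
  ... | tri< i<j _ _    = inj₂ (inj₁ (sumBelow-mono topLen topLen-pos left i j i<j))
  ... | tri≈ _ ≡.refl _ = inj₁ ≡.refl
  ... | tri> _ _ j<i    = inj₂ (inj₂ (sumBelow-mono topLen topLen-pos left j i j<i))
  separated _ _ eq | bottom i | bottom j rewrite splitAt-bottom i | splitAt-bottom j with <-cmp i j
  ... | tri< i<j _ _    = inj₂ (inj₁ (sumBelow-mono bottomLen bottomLen-pos left i j i<j))
  ... | tri≈ _ ≡.refl _ = inj₁ ≡.refl
  ... | tri> _ _ j<i    = inj₂ (inj₂ (sumBelow-mono bottomLen bottomLen-pos left j i j<i))
  separated _ _ eq | top i | bottom j rewrite splitAt-top i | splitAt-bottom j = contradiction eq λ ()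
  separated _ _ eq | bottom i | top j rewrite splitAt-bottom i | splitAt-top j = contradiction eq λ ()

  -- The half-open intervals tile each component; equality on the left yields the division points in
  -- `Interval-or-Σ`.
  locate : ∀ {x δ} → Î (x , δ) → ∃ λ a → δ ≡ row a × lower a ≤ x × x < upper a
  locate {x} {false} (l<x , x<r)
    with sum-locate topLen left x (<⇒≤ l<x) (<-respʳ-≈ (sym (left+sum topLen-sum)) x<r)
  ... | i , p , q = Inverse.to π (i ↑ˡ m) , found
    where
    found : false ≡ row (Inverse.to π (i ↑ˡ m)) × lower (Inverse.to π (i ↑ˡ m)) ≤ x ×
            x < upper (Inverse.to π (i ↑ˡ m))
    found rewrite splitAt-top i = ≡.refl , p , q
  locate {x} {true} (l<x , x<r)
    with sum-locate bottomLen left x (<⇒≤ l<x) (<-respʳ-≈ (sym (left+sum bottomLen-sum)) x<r)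
  ... | i , p , q = Inverse.to π (ℓ ↑ʳ i) , found
    where
    found : true ≡ row (Inverse.to π (ℓ ↑ʳ i)) × lower (Inverse.to π (ℓ ↑ʳ i)) ≤ x ×
            x < upper (Inverse.to π (ℓ ↑ʳ i))
    found rewrite splitAt-bottom i = ≡.refl , p , q

  Interval⊆Î : ∀ {a p} → p ∈ Interval a → p ∈ Î
  Interval⊆Î {a} (_ , l<x , x<u) = ≤-<-trans (left≤lower a) l<x , <-≤-trans x<u (upper≤right a)

  Interval-disjoint : ∀ {a b p} → p ∈ Interval a → p ∈ Interval b → a ≡ b
  Interval-disjoint {a} {b} (r , l<x , x<u) (r′ , l′<x , x<u′)
    with separated a b (≡.trans (≡.sym r) r′)
  ... | inj₁ a≡b         = a≡b
  ... | inj₂ (inj₁ u≤l′) = contradiction (<-trans l′<x x<u) u≤l′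
  ... | inj₂ (inj₂ u′≤l) = contradiction (<-trans l<x x<u′) u′≤l

  Interval∌Σ : ∀ {a p} → p ∈ Interval a → p ∉ Σ
  Interval∌Σ {a} (r , l<x , x<u) (_ , b , x≈l′ , r′) with separated a b (≡.trans (≡.sym r) r′)
  ... | inj₁ ≡.refl      = irrefl (sym x≈l′) l<x
  ... | inj₂ (inj₁ u≤l′) = u≤l′ (<-respˡ-≈ x≈l′ x<u)
  ... | inj₂ (inj₂ u′≤l) = u′≤l (<-trans (<-respʳ-≈ x≈l′ l<x) (x<x+y (lower b) (len-pos b)))

  Interval⊆Î∖Σ : ∀ {a p} → p ∈ Interval a → p ∈ Î∖Σ
  Interval⊆Î∖Σ {a} p∈ = Interval⊆Î p∈ , Interval∌Σ p∈

  Interval-or-Σ : ∀ {p} → p ∈ Î → (∃ λ a → p ∈ Interval a) ⊎ p ∈ Σ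
  Interval-or-Σ {x , δ} p∈ with locate p∈
  ... | a , r , l≤x , x<u with compare (lower a) x
  ...   | tri< l<x _ _ = inj₁ (a , r , l<x , x<u)
  ...   | tri≈ _ l≈x _ = inj₂ (p∈ , a , sym l≈x , r)
  ...   | tri> _ _ x<l = contradiction x<l l≤x

  ≈ₚ-refl : ∀ {p} → p ≈ₚ p
  ≈ₚ-refl = refl , ≡.refl

  ≈ₚ-sym : ∀ {p q} → p ≈ₚ q → q ≈ₚ p
  ≈ₚ-sym (x≈y , δ≡ε) = sym x≈y , ≡.sym δ≡ε

  ≈ₚ-trans : ∀ {p q r} → p ≈ₚ q → q ≈ₚ r → p ≈ₚ r
  ≈ₚ-trans (x≈y , δ≡ε) (y≈z , ε≡η) = trans x≈y y≈z , ≡.trans δ≡ε ε≡η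

  σ₂-cong : ∀ {p q} → p ≈ₚ q → σ₂ p ≈ₚ σ₂ q
  σ₂-cong (x≈y , δ≡ε) = x≈y , ≡.cong not δ≡ε

  σ₂-involutive : ∀ p → σ₂ (σ₂ p) ≡ p
  σ₂-involutive (x , δ) = ≡.cong (x ,_) (not-involutive δ)

  Î-cong : ∀ {p q} → p ≈ₚ q → p ∈ Î → q ∈ Î
  Î-cong (x≈y , _) (l<x , x<r) = <-respʳ-≈ x≈y l<x , <-respˡ-≈ x≈y x<r

  Interval-cong : ∀ {a p q} → p ≈ₚ q → p ∈ Interval a → q ∈ Interval a
  Interval-cong (x≈y , δ≡ε) (r , l<x , x<u) =
    ≡.trans (≡.sym δ≡ε) r , <-respʳ-≈ x≈y l<x , <-respˡ-≈ x≈y x<u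

  Σ-cong : ∀ {p q} → p ≈ₚ q → p ∈ Σ → q ∈ Σ
  Σ-cong p≈q (p∈ , a , p≈l) = Î-cong p≈q p∈ , a , ≈ₚ-trans (≈ₚ-sym p≈q) p≈l

-- The map T on the intervals

module Coding {ℝ : Reals} {A : Set} {θ : A → A}
  (θ-involutive : Involutive _≡_ θ) (L : LinearInvolution ℝ A θ) where

  open Reals ℝ hiding (zero)
  open RealLine ℝ
  open LinearInvolution L
  open Geometry lengthData

  σ₁∈Interval : ∀ {a p} → p ∈ Interval a → σ₁ p ∈ Interval (θ a)
  σ₁∈Interval {a} = proj₁ (σ₁-onto a) _

  T∈Î : ∀ {a p} → p ∈ Interval a → T p ∈ Î
  T∈Î p∈ = Interval⊆Î (σ₁∈Interval p∈)

  motion : A → Motion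
  motion a = [ translation ∘ proj₁ , symmetry ∘ proj₁ ]′ (σ₁-isometry a)

  rowAfter : A → Bool
  rowAfter a = not (row (θ a))

  T-motion : ∀ {a p} → p ∈ Interval a → T p ≈ₚ (Motion.to (motion a) (proj₁ p) , rowAfter a)
  T-motion {a} {p} p∈ = x≈ , ≡.cong not (proj₁ (σ₁∈Interval p∈))
    where
    x≈ : proj₁ (T p) ≈ Motion.to (motion a) (proj₁ p)
    x≈ with σ₁-isometry a
    ... | inj₁ (_ , translates) = translates p p∈
    ... | inj₂ (_ , reflects)   = reflects p p∈

  -- `σ₁` is given as a bare function on points; its compatibility with `_≈ₚ_` on `Interval a` comes
  -- from the motion it agrees with there.
  T-cong : ∀ {a p q} → p ∈ Interval a → p ≈ₚ q → T p ≈ₚ T q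
  T-cong {a} p∈ p≈q = ≈ₚ-trans (T-motion p∈)
    (≈ₚ-trans (Motion.to-cong (motion a) (proj₁ p≈q) , ≡.refl)
      (≈ₚ-sym (T-motion (Interval-cong p≈q p∈))))

  -- σ₂ conjugates T to its inverse.
  T-reversed : ∀ {a p} → p ∈ Interval a → T (σ₂ (T p)) ≈ₚ σ₂ p
  T-reversed {a} {p} p∈ rewrite σ₂-involutive (σ₁ p) =
    σ₂-cong (σ₁-involutive p (Interval⊆Î∖Σ p∈))

  T^-cong : ∀ n {p q y} → p ≈ₚ q → T^[ n ] p ↦ y → T^[ n ] q ↦ y
  T^-cong zero    p≈q p≈y = ≈ₚ-trans (≈ₚ-sym p≈q) p≈y
  T^-cong (suc n) p≈q ((p∈Î , p∉Σ) , Tp↦y) with Interval-or-Σ p∈Î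
  ... | inj₂ p∈Σ      = contradiction p∈Σ p∉Σ
  ... | inj₁ (a , p∈) =
        Interval⊆Î∖Σ (Interval-cong p≈q p∈) , T^-cong n (T-cong p∈ p≈q) Tp↦y

  T^-functional : ∀ n {p y z} → T^[ n ] p ↦ y → T^[ n ] p ↦ z → y ≈ₚ z
  T^-functional zero    p≈y p≈z = ≈ₚ-trans (≈ₚ-sym p≈y) p≈z
  T^-functional (suc n) (_ , y) (_ , z) = T^-functional n y z

  -- Density of the points with an infinite coding

  -- A positive form of avoiding `Σ` at time `n`: for all `n` together it provides the letters of an
  -- infinite coding and excludes `z` from `O`.
  CodedAt : ℕ → Pred Point 0ℓ
  CodedAt n z = ∃ λ a → ∃ λ y → T^[ n ] z ↦ y × y ∈ Interval a

  coded⇒∉O : ∀ {z} → (∀ n → CodedAt n z) → z ∉ O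
  coded⇒∉O coded (n , y , y∈Σ , z↦y) =
    let _ , y′ , z↦y′ , y′∈ = coded n
    in Interval∌Σ y′∈ (Σ-cong (T^-functional n z↦y z↦y′) y∈Σ)

  O-cong : ∀ {p q} → p ≈ₚ q → p ∈ O → q ∈ O
  O-cong p≈q (n , y , y∈Σ , p↦y) = n , y , y∈Σ , T^-cong n p≈q p↦y

  -- The point found by `locate` may be a division point; the open interval just to its right avoids
  -- it.
  shrink-to-Interval : ∀ δ {l r} → l < r → (∀ x → Between l r x → Between left right x) →
    ∃ λ a → ∃ λ l′ → ∃ λ r′ → l′ < r′ ×
      (∀ x → Between l′ r′ x → Between l r x × (x , δ) ∈ Interval a)
  shrink-to-Interval δ l<r sub =
    let x , l<x , x<r = dense l<r
        a , δ≡ , low≤x , x<up = locate {δ = δ} (sub x (l<x , x<r))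
        r′ , x<r′ , r′<r , r′<up = dense² x<r x<up
    in a , x , r′ , x<r′ , λ t (x<t , t<r′) →
         (<-trans l<x x<t , <-trans t<r′ r′<r) ,
         (δ≡ , ≤-<-trans low≤x x<t , <-trans t<r′ r′<up)

  -- Shrink to a part of a single `Interval a`, move it by the motion of `T`, apply the induction
  -- hypothesis to the image and pull the result back.
  coded-dense : ∀ n δ → DenseIn (Between left right) (λ x → CodedAt n (x , δ))
  coded-dense zero δ l<r sub =
    let a , l′ , r′ , l′<r′ , sub′ = shrink-to-Interval δ l<r sub
    in l′ , r′ , l′<r′ , λ x x∈ →
         let x∈₀ , x∈a = sub′ x x∈ in x∈₀ , a , (x , δ) , ≈ₚ-refl , x∈a
  coded-dense (suc n) δ l<r sub
    with shrink-to-Interval δ l<r sub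
  ... | a , l₁ , r₁ , l₁<r₁ , sub₁
    -- The image under the motion is a preimage under its inverse. Its endpoints come without an
    -- inequality; the image of a point `x` shows below that `l₂ < r₂`, and `from y` does the same
    -- for `l₄ < r₄`.
    with Motion.preimage-Between (inverseMotion (motion a)) l₁ r₁
  ... | l₂ , r₂ , into₂ , outOf₂ =
    let x , x∈₁ = dense l₁<r₁
        tx∈₂ = into₂ (to x) (Between-resp l₁ r₁ (sym (from∘to x)) x∈₁)
        l₃ , r₃ , l₃<r₃ , sub₃ = coded-dense n (rowAfter a) (<-trans (proj₁ tx∈₂) (proj₂ tx∈₂)) inI
        l₄ , r₄ , into₄ , outOf₄ = Motion.preimage-Between (motion a) l₃ r₃
        y , y∈₃ = dense l₃<r₃
        fy∈₄ = into₄ (from y) (Between-resp l₃ r₃ (sym (to∘from y)) y∈₃)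
    in l₄ , r₄ , <-trans (proj₁ fy∈₄) (proj₂ fy∈₄) , λ t t∈₄ →
         let tt∈₂ , b , z , tt↦z , z∈b = sub₃ (to t) (outOf₄ t t∈₄)
             t∈₀ , t∈a = sub₁ t (Between-resp l₁ r₁ (from∘to t) (outOf₂ (to t) tt∈₂))
         in t∈₀ , b , z , (Interval⊆Î∖Σ t∈a , T^-cong n (≈ₚ-sym (T-motion t∈a)) tt↦z) , z∈b
    where
    open Motion (motion a)
    inI : ∀ y → Between l₂ r₂ y → Between left right y
    inI y y∈ =
      let fy∈ = proj₂ (sub₁ (from y) (outOf₂ y y∈))
      in Between-resp left right (trans (proj₁ (T-motion fy∈)) (to∘from y)) (T∈Î fy∈)

  -- Cylinders, and the words they code

  Cylinder : List A → Pred Point 0ℓ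
  Cylinder []      z = z ∈ Î
  Cylinder (a ∷ w) z = z ∈ Interval a × T z ∈ Cylinder w

  Cylinder-cong : ∀ w {p q} → p ≈ₚ q → p ∈ Cylinder w → q ∈ Cylinder w
  Cylinder-cong []      p≈q p∈        = Î-cong p≈q p∈
  Cylinder-cong (a ∷ w) p≈q (p∈ , Tp) = Interval-cong p≈q p∈ , Cylinder-cong w (T-cong p∈ p≈q) Tp

  Cylinder⊆Î : ∀ w {p} → p ∈ Cylinder w → p ∈ Î
  Cylinder⊆Î []      p∈       = p∈
  Cylinder⊆Î (_ ∷ _) (p∈ , _) = Interval⊆Î p∈

  Cylinder-prefix : ∀ v w {p} → p ∈ Cylinder (v ++ w) → p ∈ Cylinder v
  Cylinder-prefix []      w p∈        = Cylinder⊆Î w p∈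
  Cylinder-prefix (a ∷ v) w (p∈ , Tp) = p∈ , Cylinder-prefix v w Tp

  Cylinder-suffix : ∀ v w → ∃ (Cylinder (v ++ w)) → ∃ (Cylinder w)
  Cylinder-suffix []      w p∈             = p∈
  Cylinder-suffix (a ∷ v) w (p , _ , Tp) = Cylinder-suffix v w (T p , Tp)

  Cylinder-resp : ∀ w δ → Respects≈ (λ x → (x , δ) ∈ Cylinder w)
  Cylinder-resp w δ x≈y = Cylinder-cong w (x≈y , ≡.refl)

  Interval-convex : ∀ a δ → Convex (λ x → (x , δ) ∈ Interval a)
  Interval-convex a δ (r , x∈) (_ , y∈) x<t t<y = r , Between-convex _ _ x∈ y∈ x<t t<y

  Interval-open : ∀ a δ → Open (λ x → (x , δ) ∈ Interval a)
  Interval-open a δ (r , x∈) = lower a , upper a , x∈ , λ t t∈ → r , t∈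

  module _ {a : A} {w : List A} {δ : Bool} where

    open Motion (motion a)

    Cylinder-∷⁺ : ∀ {x} → (x , δ) ∈ Interval a → (to x , rowAfter a) ∈ Cylinder w →
                  (x , δ) ∈ Cylinder (a ∷ w)
    Cylinder-∷⁺ x∈ tx∈ = x∈ , Cylinder-cong w (≈ₚ-sym (T-motion x∈)) tx∈

    Cylinder-∷⁻ : ∀ {x} → (x , δ) ∈ Cylinder (a ∷ w) → (to x , rowAfter a) ∈ Cylinder w
    Cylinder-∷⁻ (x∈ , Tx∈) = Cylinder-cong w (T-motion x∈) Tx∈

  -- By induction: the cylinder of `a ∷ w` is `Interval a` intersected with the preimage of that of
  -- `w` under a motion. Openness is proved in the same way.
  Cylinder-convex : ∀ w δ → Convex (λ x → (x , δ) ∈ Cylinder w)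
  Cylinder-convex []      δ = Between-convex left right
  Cylinder-convex (a ∷ w) δ x∈ y∈ x<t t<y =
    Cylinder-∷⁺ {w = w} (Interval-convex a δ (proj₁ x∈) (proj₁ y∈) x<t t<y)
      (Motion.preimage-convex (motion a) {λ x → (x , rowAfter a) ∈ Cylinder w}
        (Cylinder-convex w (rowAfter a))
        (Cylinder-∷⁻ {w = w} x∈) (Cylinder-∷⁻ {w = w} y∈) x<t t<y)

  Cylinder-open : ∀ w δ → Open (λ x → (x , δ) ∈ Cylinder w)
  Cylinder-open []      δ x∈ = Between-open left right x∈
  Cylinder-open (a ∷ w) δ x∈ =
    let l , r , x∈′ , sub = ∩-open (Interval-open a δ)
          (Motion.preimage-open (motion a) {λ x → (x , rowAfter a) ∈ Cylinder w}
            (Cylinder-open w (rowAfter a)))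
          (proj₁ x∈ , Cylinder-∷⁻ {w = w} x∈)
    in l , r , x∈′ , λ t t∈ → let t∈a , Tt = sub t t∈ in Cylinder-∷⁺ {w = w} t∈a Tt

  -- Since `Ô` contains `σ₂` of `O`, the orbits of a point and of its mirror image must both be
  -- coded; one application of Baire's theorem handles the two components together.
  coded-in-Cylinder : ∀ w {x δ} → (x , δ) ∈ Cylinder w →
    ∃ λ x′ → (x′ , δ) ∈ Cylinder w ×
      (∀ n → CodedAt n (x′ , δ)) × (∀ n → CodedAt n (x′ , not δ))
  coded-in-Cylinder w {x} {δ} x∈ =
    let l , r , (l<x , x<r) , sub = Cylinder-open w δ x∈
        x′ , x′∈ , coded = baire _ (λ n → DenseIn-∩ (coded-dense n δ) (coded-dense n (not δ)))
                             (<-trans l<x x<r) (λ t t∈ → Cylinder⊆Î w (sub t t∈))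
    in x′ , sub x′ x′∈ , proj₁ ∘ coded , proj₂ ∘ coded

  coding-tail : ∀ {z u} → IsInfiniteCoding z u → IsInfiniteCoding (T z) (u ∘ suc)
  coding-tail coding n = let y , (_ , Tz↦y) , y∈ = coding (suc n) in y , Tz↦y , y∈

  coding-prefix : ∀ w {z u} → IsInfiniteCoding z u → z ∈ Cylinder w → w ≡ applyUpTo u (length w)
  coding-prefix []      coding _          = ≡.refl
  coding-prefix (a ∷ w) coding (z∈ , Tz∈) =
    let y , z≈y , y∈ = coding zero
    in ≡.cong₂ _∷_ (Interval-disjoint (Interval-cong z≈y z∈) y∈)
         (coding-prefix w (coding-tail coding) Tz∈)

  coding⇒Cylinder : ∀ n {z u} → IsInfiniteCoding z u → z ∈ Cylinder (applyUpTo u n)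
  coding⇒Cylinder n {z} {u} coding = go n coding (head coding)
    where
    head : ∀ {z u} → IsInfiniteCoding z u → z ∈ Interval (u zero)
    head coding = let y , z≈y , y∈ = coding zero in Interval-cong (≈ₚ-sym z≈y) y∈

    go : ∀ n {z u} → IsInfiniteCoding z u → z ∈ Interval (u zero) → z ∈ Cylinder (applyUpTo u n)
    go zero    coding z∈ = Interval⊆Î z∈
    go (suc n) coding z∈ = z∈ , go n (coding-tail coding) (head (coding-tail coding))

  S : Language
  S = naturalCoding

  Cylinder⇒S : ∀ w {z} → z ∈ Cylinder w → w ∈ S
  Cylinder⇒S w {x , δ} z∈ =
    let x′ , z′∈ , coded , coded′ = coded-in-Cylinder w z∈
        coding = λ n → proj₂ (coded n)
    in (x′ , δ) , proj₁ ∘ coded , Cylinder⊆Î w z′∈ ,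
       [ coded⇒∉O coded
       -- If the point is `σ₂ p` with `p ∈ O`, then its mirror image is `p`, although the orbit of
       -- that mirror image is coded too.
       , (λ (p , p∈O , z′≈) → coded⇒∉O coded′
            (O-cong (≡.subst (_≈ₚ (x′ , not δ)) (σ₂-involutive p) (≈ₚ-sym (σ₂-cong z′≈))) p∈O))
       ]′ ,
       coding , zero , length w , coding-prefix w coding z′∈

  -- A factor at position `i` of a coding is a prefix of the coding of the `i`-th iterate.
  S⇒Cylinder : ∀ w → w ∈ S → ∃ (Cylinder w)
  S⇒Cylinder _ (z , u , _ , _ , coding , i , n , ≡.refl) = shift i coding
    where
    shift : ∀ i {z u} → IsInfiniteCoding z u → ∃ (Cylinder (applyUpTo (λ j → u (i ℕ.+ j)) n))
    shift zero    coding = _ , coding⇒Cylinder n coding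
    shift (suc i) coding = shift i (coding-tail coding)

  -- Extension graphs as intersection graphs

  private
    E : List A → Graph (A ⊎ A)
    E = extensionGraph S

  σ₂T∈Interval : ∀ {a p} → p ∈ Interval a → σ₂ (T p) ∈ Interval (θ a)
  σ₂T∈Interval {a} {p} p∈ =
    Interval-cong (refl , ≡.sym (not-involutive (proj₂ (σ₁ p)))) (σ₁∈Interval p∈)

  -- The preimage of `z` under `T` is `σ₂ (T (σ₂ z))`, because `σ₂` conjugates `T` to its inverse;
  -- it lies in `Interval a` because `θ` is an involution.
  Cylinder-∷-left : ∀ {a} w {z} → z ∈ Cylinder w → σ₂ z ∈ Interval (θ a) → ∃ (Cylinder (a ∷ w))
  Cylinder-∷-left {a} w {z} z∈ σ₂z∈ = σ₂ (T (σ₂ z)) , in-a , Cylinder-cong w (≈ₚ-sym back) z∈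
    where
    in-a : σ₂ (T (σ₂ z)) ∈ Interval a
    in-a = ≡.subst (λ b → σ₂ (T (σ₂ z)) ∈ Interval b) (θ-involutive a) (σ₂T∈Interval σ₂z∈)

    back : T (σ₂ (T (σ₂ z))) ≈ₚ z
    back = ≡.subst (T (σ₂ (T (σ₂ z))) ≈ₚ_) (σ₂-involutive z) (T-reversed σ₂z∈)

  -- For a left letter this is the part of the cylinder of `w` inside T(I_a), as T(I_a) is the image
  -- of `Interval (θ a)` under `σ₂`.
  Region : List A → A ⊎ A → Pred Point 0ℓ
  Region w (inj₁ a) z = z ∈ Cylinder w × σ₂ z ∈ Interval (θ a)
  Region w (inj₂ b) z = z ∈ Cylinder (w ∷ʳ b)

  Region⊆Cylinder : ∀ w v {z} → z ∈ Region w v → z ∈ Cylinder w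
  Region⊆Cylinder w (inj₁ a) = proj₁
  Region⊆Cylinder w (inj₂ b) = Cylinder-prefix w [ b ]

  Region-resp : ∀ w δ v → Respects≈ (λ x → (x , δ) ∈ Region w v)
  Region-resp w δ (inj₁ a) x≈y (x∈ , σx∈) = Cylinder-resp w δ x≈y x∈ , Interval-cong (x≈y , ≡.refl) σx∈
  Region-resp w δ (inj₂ b) = Cylinder-resp (w ∷ʳ b) δ

  Region-convex : ∀ w δ v → Convex (λ x → (x , δ) ∈ Region w v)
  Region-convex w δ (inj₁ a) (x∈ , σx∈) (y∈ , σy∈) x<t t<y =
    Cylinder-convex w δ x∈ y∈ x<t t<y , Interval-convex (θ a) (not δ) σx∈ σy∈ x<t t<y
  Region-convex w δ (inj₂ b) = Cylinder-convex (w ∷ʳ b) δ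

  Region-open : ∀ w δ v → Open (λ x → (x , δ) ∈ Region w v)
  Region-open w δ (inj₁ a) = ∩-open (Cylinder-open w δ) (Interval-open (θ a) (not δ))
  Region-open w δ (inj₂ b) = Cylinder-open (w ∷ʳ b) δ

  Region⇒Vertex : ∀ w v {z} → z ∈ Region w v → v ∈ Graph.Vertex (E w)
  Region⇒Vertex w (inj₁ a) (z∈ , σ₂z∈) = Cylinder⇒S (a ∷ w) (proj₂ (Cylinder-∷-left w z∈ σ₂z∈))
  Region⇒Vertex w (inj₂ b) z∈ = Cylinder⇒S (w ∷ʳ b) z∈

  Vertex⇒Region : ∀ w v → v ∈ Graph.Vertex (E w) → ∃ (Region w v)
  Vertex⇒Region w (inj₁ a) aw∈ =
    let z , z∈ , Tz∈ = S⇒Cylinder (a ∷ w) aw∈ in T z , Tz∈ , σ₂T∈Interval z∈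
  Vertex⇒Region w (inj₂ b) wb∈ = S⇒Cylinder (w ∷ʳ b) wb∈

  Cylinder-∷ʳ-unique : ∀ w {b c z} → z ∈ Cylinder (w ∷ʳ b) → z ∈ Cylinder (w ∷ʳ c) → b ≡ c
  Cylinder-∷ʳ-unique []      (z∈b , _) (z∈c , _) = Interval-disjoint z∈b z∈c
  Cylinder-∷ʳ-unique (a ∷ w) (_ , Tz∈) (_ , Tz∈′) = Cylinder-∷ʳ-unique w Tz∈ Tz∈′

  θ-injective : ∀ {a b} → θ a ≡ θ b → a ≡ b
  θ-injective {a} {b} eq = ≡.trans (≡.sym (θ-involutive a)) (≡.trans (≡.cong θ eq) (θ-involutive b))

  biExtension : ∀ w {a b z} → z ∈ Region w (inj₁ a) → z ∈ Region w (inj₂ b) → BiExt S w a b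
  biExtension w {a} {b} (_ , σ₂z∈) z∈ =
    Cylinder⇒S (a ∷ w ∷ʳ b) (proj₂ (Cylinder-∷-left (w ∷ʳ b) z∈ σ₂z∈))

  Regions-meet⇒Adj : ∀ w u v {z} → z ∈ Region w u → z ∈ Region w v → u ≡ v ⊎ Graph.Adj (E w) u v
  Regions-meet⇒Adj w (inj₁ a) (inj₁ b) (_ , σ₂z∈a) (_ , σ₂z∈b) =
    inj₁ (≡.cong inj₁ (θ-injective (Interval-disjoint σ₂z∈a σ₂z∈b)))
  Regions-meet⇒Adj w (inj₁ a) (inj₂ b) z∈a z∈b = inj₂ (biExtension w z∈a z∈b)
  Regions-meet⇒Adj w (inj₂ b) (inj₁ a) z∈b z∈a = inj₂ (biExtension w z∈a z∈b)
  Regions-meet⇒Adj w (inj₂ a) (inj₂ b) z∈a z∈b = inj₁ (≡.cong inj₂ (Cylinder-∷ʳ-unique w z∈a z∈b))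

  biExtension⇒Regions-meet : ∀ w {a b} → BiExt S w a b →
    ∃ λ z → z ∈ Region w (inj₁ a) × z ∈ Region w (inj₂ b)
  biExtension⇒Regions-meet w {a} {b} awb∈ =
    let z , z∈ , Tz∈ = S⇒Cylinder (a ∷ w ∷ʳ b) awb∈
    in T z , (Cylinder-prefix w [ b ] Tz∈ , σ₂T∈Interval z∈) , Tz∈

  Adj⇒Regions-meet : ∀ w u v → Graph.Adj (E w) u v → ∃ λ z → z ∈ Region w u × z ∈ Region w v
  Adj⇒Regions-meet w (inj₁ a) (inj₂ b) adj = biExtension⇒Regions-meet w adj
  Adj⇒Regions-meet w (inj₂ b) (inj₁ a) adj =
    let z , z∈a , z∈b = biExtension⇒Regions-meet w adj in z , z∈b , z∈a

  -- The graph is bipartite.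
  E-triangleFree : ∀ w u v v′ → Graph.Adj (E w) u v → Graph.Adj (E w) u v′ →
                   ¬ Graph.Adj (E w) v v′
  E-triangleFree w (inj₁ _) (inj₂ _) (inj₂ _) _ _ ()
  E-triangleFree w (inj₂ _) (inj₁ _) (inj₁ _) _ _ ()

  -- After `length w` steps the orbit is still in `Î`, so it is in an interval or at a division
  -- point. The second alternative is one half of a connection, and that of `extend-left` is the
  -- other half.
  extend-right : ∀ w {z} → z ∈ Cylinder w →
    (∃ λ b → z ∈ Cylinder (w ∷ʳ b)) ⊎ (∃ λ y → y ∈ Σ × T^[ length w ] z ↦ y)
  extend-right [] {z} z∈ with Interval-or-Σ z∈
  ... | inj₁ (b , z∈b) = inj₁ (b , z∈b , T∈Î z∈b)
  ... | inj₂ z∈Σ       = inj₂ (z , z∈Σ , ≈ₚ-refl)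
  extend-right (a ∷ w) (z∈ , Tz∈) with extend-right w Tz∈
  ... | inj₁ (b , Tz∈b)       = inj₁ (b , z∈ , Tz∈b)
  ... | inj₂ (y , y∈Σ , Tz↦y) = inj₂ (y , y∈Σ , Interval⊆Î∖Σ z∈ , Tz↦y)

  extend-left : ∀ {z} → z ∈ Î → (∃ λ a → σ₂ z ∈ Interval (θ a)) ⊎ z ∈ σ₂-image Σ
  extend-left {z} z∈ with Interval-or-Σ {σ₂ z} z∈
  ... | inj₁ (c , σ₂z∈c) = inj₁ (θ c , ≡.subst (λ b → σ₂ z ∈ Interval b) (≡.sym (θ-involutive c)) σ₂z∈c)
  ... | inj₂ σ₂z∈Σ = inj₂ (σ₂ z , σ₂z∈Σ , refl , ≡.sym (not-involutive (proj₂ z)))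

  rightLetter : ∀ w {z} → z ∈ Cylinder w → z ∉ O → ∃ λ b → z ∈ Cylinder (w ∷ʳ b)
  rightLetter w z∈ z∉O with extend-right w z∈
  ... | inj₁ found           = found
  ... | inj₂ (y , y∈Σ , z↦y) = contradiction (length w , y , y∈Σ , z↦y) z∉O

  leftLetter : ∀ {z} → z ∈ Î → σ₂ z ∉ O → ∃ λ a → σ₂ z ∈ Interval (θ a)
  leftLetter {z} z∈ σ₂z∉O with extend-left z∈
  ... | inj₁ found              = found
  ... | inj₂ (p , p∈Σ , z≈σ₂p) = contradiction
          (zero , p , p∈Σ , ≡.subst (σ₂ z ≈ₚ_) (σ₂-involutive p) (σ₂-cong z≈σ₂p)) σ₂z∉O

  -- Biextendability, reduced words and inverses

  S-biextendable : Biextendable S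
  S-biextendable = (letters , factors) , extensions
    where
    letters : ∀ a → [ a ] ∈ S
    letters a =
      let x , x∈ = dense (x<x+y (lower a) (len-pos a))
          z∈ : (x , row a) ∈ Interval a
          z∈ = ≡.refl , x∈
      in Cylinder⇒S [ a ] (z∈ , T∈Î z∈)

    factors : ∀ u v w → u ++ v ++ w ∈ S → v ∈ S
    factors u v w uvw∈ =
      let z , z∈ = Cylinder-suffix u (v ++ w) (S⇒Cylinder (u ++ v ++ w) uvw∈)
      in Cylinder⇒S v (Cylinder-prefix v w z∈)

    extensions : ∀ w → w ∈ S → ∃ λ a → ∃ λ b → BiExt S w a b
    extensions w w∈ =
      let _ , z∈ = S⇒Cylinder w w∈
          -- Neither this point nor its mirror image is in `O`, so it lies in a region on each side,
          -- and the two letters are adjacent.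
          _ , z′∈ , coded , coded′ = coded-in-Cylinder w z∈
          a , σ₂z′∈ = leftLetter (Cylinder⊆Î w z′∈) (coded⇒∉O coded′)
          b , z′∈b  = rightLetter w z′∈ (coded⇒∉O coded)
      in a , b , biExtension w (z′∈ , σ₂z′∈) z′∈b

  S-reduced : ∀ w → w ∈ S → w ∈ Reduced θ
  S-reduced w w∈ u a v ≡.refl =
    let z , z∈a , Tz∈θa , _ = Cylinder-suffix u (a ∷ θ a ∷ v) (S⇒Cylinder _ w∈)
    in not-¬ (≡.sym (proj₁ (σ₁∈Interval z∈a))) (≡.sym (proj₁ Tz∈θa))

  -- The accumulator `v` is a word coded from `σ₂ z`. After one step, `σ₂ (T z)` lies in
  -- `Interval (θ a)` and `T` sends it back to `σ₂ z`, so it codes `θ a ∷ v`.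
  reverse-Cylinder : ∀ w v {z} → z ∈ Cylinder w → σ₂ z ∈ Cylinder v → ∃ (Cylinder (map θ w ʳ++ v))
  reverse-Cylinder []      v z∈         σ₂z∈ = _ , σ₂z∈
  reverse-Cylinder (a ∷ w) v (z∈ , Tz∈) σ₂z∈ = reverse-Cylinder w (θ a ∷ v) Tz∈
    (σ₂T∈Interval z∈ , Cylinder-cong v (≈ₚ-sym (T-reversed z∈)) σ₂z∈)

  S-inverse : ∀ w → w ∈ S → inverse θ w ∈ S
  S-inverse w w∈ =
    let z , z∈ = S⇒Cylinder w w∈
    in Cylinder⇒S (inverse θ w) (proj₂ (reverse-Cylinder w [] z∈ (Cylinder⊆Î w z∈)))

  -- The extension graphs are trees

  module Trees (em : ExcludedMiddle 0ℓ) (noConnections : WithoutConnections) where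

    Region-cover : ∀ w {z} → z ∈ Cylinder w → ∃ λ v → z ∈ Region w v
    Region-cover w {z} z∈ with extend-left (Cylinder⊆Î w z∈) | extend-right w z∈
    ... | inj₁ (a , σ₂z∈) | _ = inj₁ a , z∈ , σ₂z∈
    ... | _ | inj₁ (b , z∈b) = inj₂ b , z∈b
    ... | inj₂ z∈σ₂Σ | inj₂ (y , y∈Σ , z↦y) =
          contradiction (z∈σ₂Σ , y∈Σ , z↦y) (noConnections z y (length w))

    -- An intersection graph needs all its sets on one line, so the vertices `X` are those whose
    -- regions lie in the component `δ`. With `X` all vertices this is the graph of a nonempty word;
    -- with `X` the vertices of one component it is a half of the graph of the empty word.
    E-tree : ∀ w δ (X : Pred (A ⊎ A) 0ℓ) →
      (∀ v → v ∈ X → v ∈ Graph.Vertex (E w)) →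
      (∀ v {x} → (x , δ) ∈ Region w v → v ∈ X) →
      (∀ v {z} → v ∈ X → z ∈ Region w v → proj₂ z ≡ δ) →
      (∃ λ x → (x , δ) ∈ Cylinder w) →
      Graph.IsTree (withVertices (E w) X)
    E-tree w δ X X⇒Vertex Region⇒X inRow =
      IntersectionGraph.isTree em (withVertices (E w) X)
        (λ x → (x , δ) ∈ Cylinder w) (Cylinder-resp w δ) (Cylinder-convex w δ)
        (λ v x → (x , δ) ∈ Region w v)
        (Region-resp w δ) (Region-convex w δ) (Region-open w δ)
        (λ v → Region⊆Cylinder w v) (Region-cover w)
        (λ {v} → Region⇒X v)
        (λ {v} v∈ → let z , z∈ = Vertex⇒Region w v (X⇒Vertex v v∈)
                    in proj₁ z , onRow v z∈ (inRow v v∈ z∈))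
        (λ {u} {v} → Regions-meet⇒Adj w u v)
        (λ {u} {v} (u∈ , v∈ , adj) →
          let z , zu , zv = Adj⇒Regions-meet w u v adj
          in proj₁ z , onRow u zu (inRow u u∈ zu) , onRow v zv (inRow v v∈ zv))
        (λ {u} {v} {v′} → E-triangleFree w u v v′)
      where
      onRow : ∀ v {z} → z ∈ Region w v → proj₂ z ≡ δ → (proj₁ z , δ) ∈ Region w v
      onRow _ z∈ ≡.refl = z∈

    S-tree : ∀ w → w ∈ S → w ≢ [] → Graph.IsTree (E w)
    S-tree []      _  w≢[] = contradiction ≡.refl w≢[]
    -- The cylinder of a nonempty word stays in the component of its first letter.
    S-tree w@(c ∷ w′) w∈ _ = E-tree w (row c) (Graph.Vertex (E w)) (λ _ → id)
      (λ v → Region⇒Vertex w v) (λ v _ z∈ → proj₁ (proj₁ (Region⊆Cylinder w v z∈)))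
      (nonempty (S⇒Cylinder w w∈))
      where
      nonempty : ∃ (Cylinder w) → ∃ λ x → (x , row c) ∈ Cylinder w
      nonempty ((x , _) , z∈@((≡.refl , _) , _)) = x , z∈

    -- The component of `Î` that contains T(I_a) for a left letter `a`, and I_b for a right letter
    -- `b`.
    component : A ⊎ A → Bool
    component (inj₁ a) = not (row (θ a))
    component (inj₂ b) = row b

    Region-component : ∀ v {z} → z ∈ Region [] v → proj₂ z ≡ component v
    Region-component (inj₁ a) {_ , δ} (_ , σ₂z∈) =
      ≡.trans (≡.sym (not-involutive δ)) (≡.cong not (proj₁ σ₂z∈))
    Region-component (inj₂ b) (z∈ , _) = proj₁ z∈

    E[]-twoTrees : IsDisjointUnionOfTwoTrees (E [])
    E[]-twoTrees = component , same , λ δ → E-tree [] δ _ (λ _ → proj₁)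
      (λ v z∈ → Region⇒Vertex [] v z∈ , ≡.sym (Region-component v z∈))
      (λ v (_ , v∈δ) z∈ → ≡.trans (Region-component v z∈) v∈δ)
      (dense left<right)
      where
      same : ∀ u v → Graph.Edge (E []) u v → component u ≡ component v
      same u v (_ , _ , adj) =
        let z , zu , zv = Adj⇒Regions-meet [] u v adj
        in ≡.trans (≡.sym (Region-component u zu)) (Region-component v zv)

theorem5p9 : ExcludedMiddle 0ℓ →
    (ℝ : Reals) (A : Set) (θ : A → A) →
    Involutive _≡_ θ →
    (T : LinearInvolution ℝ A θ) →
    LinearInvolution.WithoutConnections T →
    Specular θ (LinearInvolution.naturalCoding T)
theorem5p9 em ℝ A θ θ-involutive L noConnections =
  S-biextendable , S-reduced , S-inverse , S-biextendable , S-tree , E[]-twoTrees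
  where
  open Coding θ-involutive L
  open Trees em noConnections
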